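{- Let $k$ be a positive integer and $\lambda$ a partition with at most $k$ rows. Then the formal power series $\mathrm{ss}_\lambda(\mathbf{y})=\sum_{S\in\mathrm{SSOT}_k(\lambda)}\mathbf{y}^S$ in $\mathbf{y}=(y_1,\dots,y_k)$ is symmetric, i.e. invariant under all permutations of $y_1,\dots,y_k$.
   Context: Partitions are identified with Young diagrams in English notation. A skew shape is a horizontal strip if it contains at most one box in each column. A $k$-semistandard oscillating tableau ($k$-SSOT) of final shape $\lambda$ is a finite sequence of partitions $S=(S^{1},S'^{2},S^{2},S'^{3},\dots,S'^{k},S^{k})$ such that, with $S'^{1}=\emptyset$: $S^{i}\supseteq S'^{i+1}$ and $S^i\setminus S'^{i+1}$ is a (possibly empty) horizontal strip for $1\le i\le k-1$; $S'^{i}\subseteq S^{i}$ and $S^i\setminus S'^i$ is a (possibly empty) horizontal strip for $1\le i\le k$; and $S^k=\lambda$. $\mathrm{SSOT}_k(\lambda)$ is the set of these. Step $i$ consists of deleting the boxes of $S^{i-1}\setminus S'^{i}$ (for $i\ge2$) and then adding the boxes of $S^i\setminus S'^i$. $S$ is identified with the multiset-valued tableau in which $i$ is recorded at a position $(l,m)$ once for each time that box is added or deleted in step $i$; $S(l,m)$ denotes the multiset at $(l,m)$. The weight is $\mathbf{y}^S=\prod_{l,m}\prod_{j\in S(l,m)}y_j$ (so the exponent of $y_i$ is the total number of boxes deleted and added in step $i$). -}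

module Defs where

open import Data.Fin.Base using (Fin; zero; suc)
open import Data.Fin.Permutation using (Permutation′; _⟨$⟩ʳ_)
open import Data.Fin.Properties using (injective⇒≤)
open import Data.List.Base using (List; []; _∷_; _++_; length; map; filter; upTo; cartesianProduct; cartesianProductWith; deduplicate; mapMaybe)
import Data.List.Base as List
open import Data.List.Membership.Propositional using (_∈_)
open import Data.List.Membership.Propositional.Properties
open import Data.List.Properties using (length-map; length-upTo; length-++)
import Data.List.Properties as Listₚ
open import Data.List.Relation.Binary.Subset.Propositional using (_⊆_)
open import Data.List.Relation.Unary.All as All using (All; []; _∷_)
open import Data.List.Relation.Unary.AllPairs using ([]; _∷_)
open import Data.List.Relation.Unary.Any as Any using (here; there; index)
import Data.List.Relation.Unary.Any.Properties as Anyₚ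
open import Data.List.Relation.Unary.Linked as Linked using (Linked; []; [-]; _∷_)
open import Data.List.Relation.Unary.Unique.Propositional using (Unique)
import Data.List.Relation.Unary.Unique.Propositional.Properties as Uniqueₚ
open import Data.Maybe.Base using (Maybe; just; nothing)
import Data.Maybe.Relation.Unary.Any as MAny
open import Data.Nat.Base using (ℕ; zero; suc; _+_; _≤_; _<_; _≥_; z≤n; s≤s)
import Data.Nat.Properties as ℕₚ
open import Data.Product.Base using (_×_; _,_; proj₁; proj₂)
import Data.Product.Properties as Productₚ
open import Data.Sum.Base using (inj₁; inj₂)
open import Data.Vec.Base as Vec using (Vec; []; _∷_)
import Data.Vec.Properties as Vecₚ
import Data.Vec.Relation.Unary.All as VAll
open import Function.Base using (_∘_)
open import Function.Bundles using (_⇔_; mk⇔)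
open import Relation.Binary.Definitions using (DecidableEquality)
open import Relation.Binary.PropositionalEquality
open import Relation.Nullary using (Dec; yes; no; ¬?; contradiction; map′; _×-dec_; _→-dec_)

record Partition : Set where
  constructor mkPartition
  field
    parts      : List ℕ
    decreasing : Linked _≥_ parts
    positive   : All (0 <_) parts

open Partition public

∅ : Partition
∅ = mkPartition [] [] []

rows : Partition → ℕ
rows = length ∘ parts

-- A box (l , m) lies in row l and column m, both counted from 0.
Box : Set
Box = ℕ × ℕ

-- The boxes of a diagram whose top row is row l.
boxesFrom : ℕ → List ℕ → List Box
boxesFrom l []       = []
boxesFrom l (x ∷ xs) = map (l ,_) (upTo x) ++ boxesFrom (suc l) xs

boxes : Partition → List Box
boxes μ = boxesFrom 0 (parts μ)

_≟ᴮ_ : DecidableEquality Box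
_≟ᴮ_ = Productₚ.≡-dec ℕₚ._≟_ ℕₚ._≟_

open import Data.List.Membership.DecPropositional _≟ᴮ_ using (_∈?_)
open import Data.List.Relation.Binary.Subset.DecPropositional _≟ᴮ_ using (_⊆?_)

infix 6 _∖_

-- A skew shape only when ν is contained in μ; HorizontalStrip requires this separately.
_∖_ : Partition → Partition → List Box
μ ∖ ν = filter (λ b → ¬? (b ∈? boxes ν)) (boxes μ)

record HorizontalStrip (μ ν : Partition) : Set where
  constructor strip
  field
    contains : boxes ν ⊆ boxes μ
    columns  : ∀ {l l′ m} → (l , m) ∈ μ ∖ ν → (l′ , m) ∈ μ ∖ ν → l ≡ l′

-- (S′¹ , S¹) ∷ (S′² , S²) ∷ … ∷ (S′ᵏ , Sᵏ) ∷ []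
Sequence : ℕ → Set
Sequence k = Vec (Partition × Partition) k

data Oscillates : ∀ {k} → Partition → Sequence k → Partition → Set where
  done : ∀ {μ} → Oscillates μ [] μ
  step : ∀ {k μ ν′ ν κ} {S : Sequence k} →
         HorizontalStrip μ ν′ → HorizontalStrip ν ν′ →
         Oscillates ν S κ → Oscillates μ ((ν′ , ν) ∷ S) κ

-- Starting from S⁰ = ∅ makes the first deletion empty, that is, it imposes
-- the convention S′¹ = ∅ (see S′¹≡∅).
IsSSOT : ∀ {k} → Partition → Sequence k → Set
IsSSOT κ S = Oscillates ∅ S κ

weightFrom : ∀ {k} → Partition → Sequence k → Vec ℕ k
weightFrom μ []             = []
weightFrom μ ((ν′ , ν) ∷ S) =
  (length (μ ∖ ν′) + length (ν ∖ ν′)) ∷ weightFrom ν S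

-- The exponent vector of y^S: step i records the label i once at each box it
-- deletes and once at each box it adds, each record contributing a factor yᵢ.
weight : ∀ {k} → Sequence k → Vec ℕ k
weight = weightFrom ∅

S′¹≡∅ : ∀ {k κ ν′ ν} {S : Sequence k} → IsSSOT κ ((ν′ , ν) ∷ S) → ν′ ≡ ∅
S′¹≡∅ {ν′ = mkPartition [] [] []} (step _ _ _) = refl
S′¹≡∅ {ν′ = mkPartition (zero ∷ _) _ (() ∷ _)}
S′¹≡∅ {ν′ = mkPartition (suc x ∷ xs) _ _} (step h _ _)
  with () ← HorizontalStrip.contains h (here refl)

parts-injective : ∀ {μ ν} → parts μ ≡ parts ν → μ ≡ ν
parts-injective {mkPartition _ d p} {mkPartition _ d′ p′} refl =
  cong₂ (mkPartition _) (Linked.irrelevant ℕₚ.≤-irrelevant d d′)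
                        (All.irrelevant ℕₚ.≤-irrelevant p p′)

_≟ᴾ_ : DecidableEquality Partition
μ ≟ᴾ ν = map′ parts-injective (cong parts) (Listₚ.≡-dec ℕₚ._≟_ (parts μ) (parts ν))

_≟ˢ_ : ∀ {k} → DecidableEquality (Sequence k)
_≟ˢ_ = Vecₚ.≡-dec (Productₚ.≡-dec _≟ᴾ_ _≟ᴾ_)

horizontalStrip? : ∀ μ ν → Dec (HorizontalStrip μ ν)
horizontalStrip? μ ν =
  map′ (λ (c , a) → strip (λ {b} → c {b}) λ b∈ b′∈ → All.lookup (All.lookup a b∈) b′∈ refl)
       (λ h → (λ {b} → HorizontalStrip.contains h {b}) ,
              All.tabulate λ b∈ → All.tabulate λ b′∈ →
                λ { refl → HorizontalStrip.columns h b∈ b′∈ })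
       (boxes ν ⊆? boxes μ ×-dec
        All.all? (λ b → All.all? (λ b′ → (proj₂ b ℕₚ.≟ proj₂ b′) →-dec
                                         (proj₁ b ℕₚ.≟ proj₁ b′)) (μ ∖ ν)) (μ ∖ ν))

oscillates? : ∀ {k} μ (S : Sequence k) κ → Dec (Oscillates μ S κ)
oscillates? μ [] κ = map′ (λ { refl → done }) (λ { done → refl }) (μ ≟ᴾ κ)
oscillates? μ ((ν′ , ν) ∷ S) κ =
  map′ (λ (h , h′ , o) → step h h′ o) (λ { (step h h′ o) → h , h′ , o })
       (horizontalStrip? μ ν′ ×-dec horizontalStrip? ν ν′ ×-dec oscillates? ν S κ)

-- All lists of length at most r with entries at most n.
lists : ℕ → ℕ → List (List ℕ)
lists n zero    = [] ∷ []
lists n (suc r) = [] ∷ cartesianProductWith _∷_ (upTo (suc n)) (lists n r)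

toPartition : List ℕ → Maybe Partition
toPartition xs with Linked.linked? ℕₚ._≥?_ xs | All.all? (0 ℕₚ.<?_) xs
... | yes d | yes p = just (mkPartition xs d p)
... | _     | _     = nothing

partitions : ℕ → List Partition
partitions n = mapMaybe toPartition (lists n n)

sequences : ℕ → (k : ℕ) → List (Sequence k)
sequences n zero    = [] ∷ []
sequences n (suc k) =
  cartesianProductWith _∷_ (cartesianProduct (partitions n) (partitions n)) (sequences n k)

-- The boxes occurring in a tableau number at most the sum of its exponents,
-- so the search is bounded by that sum (see ∈-tableaux).
tableaux : (k : ℕ) → Partition → Vec ℕ k → List (Sequence k)
tableaux k κ α =
  deduplicate _≟ˢ_
    (filter (λ S → oscillates? ∅ S κ ×-dec Vecₚ.≡-dec ℕₚ._≟_ (weight S) α)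
            (sequences (Vec.sum α) k))

tableaux-unique : ∀ k κ α → Unique (tableaux k κ α)
tableaux-unique k κ α = deduplicate-! _
  where open import Data.List.Relation.Unary.Unique.DecPropositional.Properties (_≟ˢ_ {k}) using (deduplicate-!)

lists-complete : ∀ {n} r xs → length xs ≤ r → All (_≤ n) xs → xs ∈ lists n r
lists-complete zero    []       _       _        = here refl
lists-complete (suc r) []       _       _        = here refl
lists-complete (suc r) (x ∷ xs) (s≤s p) (q ∷ qs) =
  there (∈-cartesianProductWith⁺ _∷_ (∈-upTo⁺ (s≤s q)) (lists-complete r xs p qs))

toPartition-complete : ∀ μ → toPartition (parts μ) ≡ just μ
toPartition-complete (mkPartition xs d p)
  with Linked.linked? ℕₚ._≥?_ xs | All.all? (0 ℕₚ.<?_) xs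
... | yes _ | yes _ = cong just (parts-injective refl)
... | yes _ | no ¬p = contradiction p ¬p
... | no ¬d | _     = contradiction d ¬d

length-mono : ∀ {xs ys : List Box} → Unique xs → xs ⊆ ys → length xs ≤ length ys
length-mono {xs} {ys} u xs⊆ys = injective⇒≤ {f = f} λ {i} {j} eq →
  lookup-inj u (trans (Anyₚ.lookup-index (xs⊆ys (∈-lookup i)))
               (trans (cong (List.lookup ys) eq)
                      (sym (Anyₚ.lookup-index (xs⊆ys (∈-lookup j))))))
  where
  f : Fin (length xs) → Fin (length ys)
  f i = index (xs⊆ys (∈-lookup i))

  lookup-inj : ∀ {zs : List Box} → Unique zs → ∀ {i j} →
               List.lookup zs i ≡ List.lookup zs j → i ≡ j
  lookup-inj (_ ∷ _)  {zero}  {zero}  _  = refl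
  lookup-inj (px ∷ _) {zero}  {suc j} eq = contradiction eq (All.lookup px (∈-lookup j))
  lookup-inj (px ∷ _) {suc i} {zero}  eq = contradiction (sym eq) (All.lookup px (∈-lookup i))
  lookup-inj (_ ∷ u)  {suc i} {suc j} eq = cong suc (lookup-inj u eq)

row≤ : ∀ l xs {b} → b ∈ boxesFrom l xs → l ≤ proj₁ b
row≤ l (x ∷ xs) b∈ with ∈-++⁻ (map (l ,_) (upTo x)) b∈
... | inj₁ p with _ , _ , refl ← ∈-map⁻ (l ,_) p = ℕₚ.≤-refl
... | inj₂ p = ℕₚ.<⇒≤ (row≤ (suc l) xs p)

boxesFrom-unique : ∀ l xs → Unique (boxesFrom l xs)
boxesFrom-unique l []       = []
boxesFrom-unique l (x ∷ xs) =
  Uniqueₚ.++⁺ (Uniqueₚ.map⁺ (cong proj₂) (Uniqueₚ.upTo⁺ x)) (boxesFrom-unique (suc l) xs) disjoint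
  where
  disjoint : ∀ {b} → b ∈ map (l ,_) (upTo x) × b ∈ boxesFrom (suc l) xs → _
  disjoint (p , q) with _ , _ , refl ← ∈-map⁻ (l ,_) p = ℕₚ.<-irrefl refl (row≤ (suc l) xs q)

size : Partition → ℕ
size = length ∘ boxes

length-boxesFrom : ∀ l x xs → length (boxesFrom l (x ∷ xs)) ≡ x + length (boxesFrom (suc l) xs)
length-boxesFrom l x xs =
  trans (length-++ (map (l ,_) (upTo x)))
        (cong (_+ length (boxesFrom (suc l) xs)) (trans (length-map _ (upTo x)) (length-upTo x)))

parts≤ : ∀ l xs → All (_≤ length (boxesFrom l xs)) xs
parts≤ l []       = []
parts≤ l (x ∷ xs) rewrite length-boxesFrom l x xs =
  ℕₚ.m≤m+n x _ ∷ All.map (λ p → ℕₚ.≤-trans p (ℕₚ.m≤n+m _ x)) (parts≤ (suc l) xs)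

rows≤ : ∀ l {xs} → All (0 <_) xs → length xs ≤ length (boxesFrom l xs)
rows≤ l []                         = z≤n
rows≤ l {x ∷ xs} (p ∷ ps) rewrite length-boxesFrom l x xs = ℕₚ.+-mono-≤ p (rows≤ (suc l) ps)

partitions-complete : ∀ {n} μ → size μ ≤ n → μ ∈ partitions n
partitions-complete {n} μ p = Anyₚ.mapMaybe⁺ toPartition (lists n n)
  (Any.map (λ eq → subst (MAny.Any (μ ≡_)) (trans (sym (toPartition-complete μ)) eq) (MAny.just refl))
    (∈-map⁺ toPartition
      (lists-complete n (parts μ) (ℕₚ.≤-trans (rows≤ 0 (positive μ)) p)
        (All.map (λ q → ℕₚ.≤-trans q p) (parts≤ 0 (parts μ))))))

sequences-complete : ∀ {n k} {S : Sequence k} →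
  VAll.All (λ (ν′ , ν) → size ν′ ≤ n × size ν ≤ n) S → S ∈ sequences n k
sequences-complete VAll.[]             = here refl
sequences-complete ((p , q) VAll.∷ ps) =
  ∈-cartesianProductWith⁺ _∷_
    (∈-cartesianProduct⁺ (partitions-complete _ p) (partitions-complete _ q))
    (sequences-complete ps)

size-∖ : ∀ μ ν → size μ ≤ size ν + length (μ ∖ ν)
size-∖ μ ν = subst (size μ ≤_) (length-++ (boxes ν))
  (length-mono (boxesFrom-unique 0 (parts μ)) λ {b} b∈ → split b b∈)
  where
  split : ∀ b → b ∈ boxes μ → b ∈ boxes ν ++ (μ ∖ ν)
  split b b∈ with b ∈? boxes ν
  ... | yes p = ∈-++⁺ˡ p
  ... | no ¬p = ∈-++⁺ʳ (boxes ν) (∈-filter⁺ (λ c → ¬? (c ∈? boxes ν)) b∈ ¬p)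

sizes-bounded : ∀ {k n μ κ} {S : Sequence k} → Oscillates μ S κ →
  size μ + Vec.sum (weightFrom μ S) ≤ n → VAll.All (λ (ν′ , ν) → size ν′ ≤ n × size ν ≤ n) S
sizes-bounded done _ = VAll.[]
sizes-bounded {n = n} {μ} (step {ν′ = ν′} {ν} {S = S} h _ o) p =
  (ℕₚ.≤-trans ν′≤μ (ℕₚ.m+n≤o⇒m≤o _ p) , ℕₚ.m+n≤o⇒m≤o _ q) VAll.∷ sizes-bounded o q
  where
  ν′≤μ : size ν′ ≤ size μ
  ν′≤μ = length-mono (boxesFrom-unique 0 (parts ν′)) (HorizontalStrip.contains h)

  open ℕₚ.≤-Reasoning
  w = Vec.sum (weightFrom ν S)
  a = length (ν ∖ ν′)
  d = length (μ ∖ ν′)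

  q : size ν + w ≤ n
  q = begin
    size ν + w             ≤⟨ ℕₚ.+-monoˡ-≤ w (size-∖ ν ν′) ⟩
    size ν′ + a + w        ≤⟨ ℕₚ.+-monoˡ-≤ w (ℕₚ.+-mono-≤ ν′≤μ (ℕₚ.m≤n+m a d)) ⟩
    size μ + (d + a) + w   ≡⟨ ℕₚ.+-assoc (size μ) (d + a) w ⟩
    size μ + (d + a + w)   ≤⟨ p ⟩
    n                      ∎

∈-tableaux : ∀ {k κ α} {S : Sequence k} → S ∈ tableaux k κ α ⇔ (IsSSOT κ S × weight S ≡ α)
∈-tableaux {k} {κ} {α} {S} = mk⇔
  (λ S∈ → proj₂ (∈-filter⁻ P? {xs = sequences (Vec.sum α) k} (∈-deduplicate⁻ _≟ˢ_ _ S∈)))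
  (λ { (o , refl) → ∈-deduplicate⁺ _≟ˢ_
         (∈-filter⁺ P? (sequences-complete (sizes-bounded o ℕₚ.≤-refl)) (o , refl)) })
  where
  P? : ∀ T → Dec (IsSSOT κ T × weight T ≡ α)
  P? T = oscillates? ∅ T κ ×-dec Vecₚ.≡-dec ℕₚ._≟_ (weight T) α

-- A power series in y₁, …, yₖ, as the function sending an exponent vector to
-- its coefficient; natural number coefficients suffice here.
PowerSeries : ℕ → Set
PowerSeries k = Vec ℕ k → ℕ

-- f(y_σ(1), …, y_σ(k)). Substituting y_σ(i) for yᵢ turns y^β into the y^α with
-- α_σ(i) = βᵢ, so the coefficient of y^α in the result is that of y^β in f.
permuteVariables : ∀ {k} → Permutation′ k → PowerSeries k → PowerSeries k
permuteVariables σ f α = f (Vec.tabulate λ i → Vec.lookup α (σ ⟨$⟩ʳ i))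

Symmetric : ∀ {k} → PowerSeries k → Set
Symmetric {k} f = ∀ (σ : Permutation′ k) α → permuteVariables σ f α ≡ f α

-- Σ_S y^S over the k-semistandard oscillating tableaux S of final shape κ: by
-- tableaux-unique and ∈-tableaux, the coefficient of y^α is the number of such
-- S with weight S ≡ α.
ss : (k : ℕ) → Partition → PowerSeries k
ss k κ α = length (tableaux k κ α)

{-# OPTIONS --safe #-}
-- Let Uₓ and Dₓ add and delete a horizontal strip, weighted by its size. Step i
-- is the operator Uᵢ Dᵢ, and two such operators commute because the U's
-- commute, the D's commute, and DₓU_y = (1 - xy)⁻¹ U_y Dₓ. These three facts
-- are realised by one involution. Writing diagrams by their row lengths, let
-- M ⊇ A ⊆ S ⊇ B ⊆ K be two consecutive steps. Reflecting S (i + 1) in the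
-- interval [max (A (i + 1)) (B (i + 1)) , min (A i) (B i)] to which the strip
-- conditions confine it gives a diagram R with A ⊇ R ⊆ B, while
-- S 0 - max (A 0) (B 0) is kept as the exponent of xy. Then A and B are replaced
-- by their Bender–Knuth reflections between M, R and between K, R, and S is
-- rebuilt from R by the first reflection. This exchanges the weights of the
-- two steps and fixes M and K. Adjacent transpositions generate all
-- permutations.
module Submission where

open import Defs
open import Data.Nat.Base using (ℕ; NonZero; _≤_)
open import Data.Fin.Base as Fin using (Fin)
open import Data.Fin.Permutation as Perm using (Permutation′; _⟨$⟩ʳ_)
open import Data.Fin.Properties using (injective⇒≤)
open import Data.List.Base as List using (List; []; _∷_; _++_; length; map; upTo)
open import Data.List.Membership.DecPropositional _≟ᴮ_ using (_∈?_)
open import Data.List.Membership.Propositional using (_∈_)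
open import Data.List.Membership.Propositional.Properties
open import Data.List.Properties using (length-++)
open import Data.List.Relation.Unary.All as All using (All; []; _∷_)
open import Data.List.Relation.Unary.AllPairs using (_∷_)
open import Data.List.Relation.Unary.Any using (index)
import Data.List.Relation.Unary.Any.Properties as Anyₚ
open import Data.List.Relation.Unary.Linked using (Linked; []; [-]; _∷_)
open import Data.List.Relation.Unary.Unique.Propositional using (Unique)
import Data.List.Relation.Unary.Unique.Propositional.Properties as Uniqueₚ
open import Data.Nat.Base using (zero; suc; _+_; _∸_; _⊔_; _⊓_; _<_; _≥_; _≮_; z≤n; s≤s; z<s)
open import Data.Nat.Properties
open import Data.Nat.Tactic.RingSolver using (solve-∀)
open import Data.Product.Base using (_×_; _,_; proj₁; proj₂)
import Data.Product.Properties as Productₚ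
open import Data.Sum.Base using (_⊎_; inj₁; inj₂)
open import Data.Vec.Base as Vec using (Vec; []; _∷_)
import Data.Vec.Properties as Vecₚ
open import Function.Base using (_∘_; _$_)
open import Function.Bundles using (Equivalence)
open import Relation.Binary.Definitions using (tri<; tri≈; tri>)
open import Relation.Binary.PropositionalEquality
open import Relation.Nullary using (¬?; contradiction)

-- Finite sums and reflections in an interval

Σ[<_] : ℕ → (ℕ → ℕ) → ℕ
Σ[< zero  ] f = 0
Σ[< suc n ] f = Σ[< n ] f + f n

Σ-0 : ∀ n → Σ[< n ] (λ _ → 0) ≡ 0
Σ-0 zero    = refl
Σ-0 (suc n) = cong (_+ 0) (Σ-0 n)

Σ-suc : ∀ n f → Σ[< suc n ] f ≡ f 0 + Σ[< n ] (f ∘ suc)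
Σ-suc zero    f = sym (+-identityʳ (f 0))
Σ-suc (suc n) f = trans (cong (_+ f (suc n)) (Σ-suc n f)) (+-assoc (f 0) _ _)

-- The order-reversing involution of the interval from `l` to `h`; there `x ≤ l + h`, so the
-- subtraction never truncates.
reflect : ℕ → ℕ → ℕ → ℕ
reflect l h x = l + h ∸ x

module _ {l h x : ℕ} where
  reflect-≥ : x ≤ h → l ≤ reflect l h x
  reflect-≥ x≤h = ≤-trans (≤-reflexive (sym (m+n∸n≡m l h))) (∸-monoʳ-≤ (l + h) x≤h)

  reflect-≤ : l ≤ x → reflect l h x ≤ h
  reflect-≤ l≤x = ≤-trans (∸-monoʳ-≤ (l + h) l≤x) (≤-reflexive (m+n∸m≡n l h))

  reflect-involutive : x ≤ h → reflect l h (reflect l h x) ≡ x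
  reflect-involutive x≤h = m∸[m∸n]≡n (m≤n⇒m≤o+n l x≤h)

  reflect-+ : x ≤ h → reflect l h x + x ≡ l + h
  reflect-+ x≤h = m∸n+n≡m (m≤n⇒m≤o+n l x≤h)

⊔-+-⊓ : ∀ m n → (m ⊔ n) + (m ⊓ n) ≡ m + n
⊔-+-⊓ m n with ≤-total m n
... | inj₁ m≤n = trans (cong₂ _+_ (m≤n⇒m⊔n≡n m≤n) (m≤n⇒m⊓n≡m m≤n)) (+-comm n m)
... | inj₂ n≤m = cong₂ _+_ (m≥n⇒m⊔n≡m n≤m) (m≥n⇒m⊓n≡n n≤m)

-- Horizontal strips as interlacing sequences

infix 4 _≽_

-- For row lengths this is the horizontal strip condition `f 0 ≥ g 0 ≥ f 1 ≥ g 1 ≥ …`, a chain that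
-- makes both sequences decreasing.
record _≽_ (f g : ℕ → ℕ) : Set where
  field
    upper : ∀ i → g i ≤ f i
    lower : ∀ i → f (suc i) ≤ g i

  decreasingˡ : ∀ i → f (suc i) ≤ f i
  decreasingˡ i = ≤-trans (lower i) (upper i)

  decreasingʳ : ∀ i → g (suc i) ≤ g i
  decreasingʳ i = ≤-trans (upper (suc i)) (lower i)

  0ˡ⇒0ʳ : ∀ {i} → f i ≡ 0 → g i ≡ 0
  0ˡ⇒0ʳ {i} f0 = n≤0⇒n≡0 (≤-trans (upper i) (≤-reflexive f0))

  0ʳ⇒0ˡ : ∀ {i} → g i ≡ 0 → f (suc i) ≡ 0
  0ʳ⇒0ˡ {i} g0 = n≤0⇒n≡0 (≤-trans (lower i) (≤-reflexive g0))

open _≽_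

-- Bender–Knuth reflection

module BenderKnuth (M : ℕ → ℕ) where

  module _ (R : ℕ → ℕ) where
    -- For fixed `M` and `R`, the conditions `M ≽ A` and `A ≽ R` amount to separate bounds on each
    -- `A i`, so the rows can be reflected independently. Nothing in `R` bounds row 0 from above.
    bot top : ℕ → ℕ
    bot i       = M (suc i) ⊔ R i
    top zero    = M 0
    top (suc i) = M (suc i) ⊓ R i

    bk : (ℕ → ℕ) → ℕ → ℕ
    bk A i = reflect (bot i) (top i) (A i)

    top≤M : ∀ i → top i ≤ M i
    top≤M zero    = ≤-refl
    top≤M (suc i) = m⊓n≤m _ _

  module _ {R A : ℕ → ℕ} where
    bot≤ : M ≽ A → A ≽ R → ∀ i → bot R i ≤ A i
    bot≤ m r i = ⊔-lub (lower m i) (upper r i)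

    ≤top : M ≽ A → A ≽ R → ∀ i → A i ≤ top R i
    ≤top m r zero    = upper m 0
    ≤top m r (suc i) = ⊓-glb (upper m (suc i)) (lower r i)

    M≽ : (∀ i → bot R i ≤ A i) → (∀ i → A i ≤ top R i) → M ≽ A
    M≽ b t .upper i = ≤-trans (t i) (top≤M R i)
    M≽ b t .lower i = m⊔n≤o⇒m≤o _ _ (b i)

    ≽R : (∀ i → bot R i ≤ A i) → (∀ i → A i ≤ top R i) → A ≽ R
    ≽R b t .upper i = m⊔n≤o⇒n≤o (M (suc i)) _ (b i)
    ≽R b t .lower i = ≤-trans (t (suc i)) (m⊓n≤n (M (suc i)) _)

  module _ {R A : ℕ → ℕ} (m : M ≽ A) (r : A ≽ R) where
    private
      ≥bot : ∀ i → bot R i ≤ bk R A i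
      ≥bot i = reflect-≥ (≤top m r i)

      top≥ : ∀ i → bk R A i ≤ top R i
      top≥ i = reflect-≤ {bot R i} (bot≤ m r i)

    M≽bk : M ≽ bk R A
    M≽bk = M≽ ≥bot top≥

    bk≽R : bk R A ≽ R
    bk≽R = ≽R ≥bot top≥

    bk-involutive : ∀ i → bk R (bk R A) i ≡ A i
    bk-involutive i = reflect-involutive {bot R i} (≤top m r i)

    bk-+ : ∀ i → bk R A i + A i ≡ bot R i + top R i
    bk-+ i = reflect-+ {bot R i} (≤top m r i)

    -- The maximum of the pair (M (suc i) , R i) sits in bot R i and its
    -- minimum in top R (suc i), so the sum telescopes.
    Σ-bk-top : ∀ n → Σ[< n ] (bk R A) + Σ[< n ] A + top R n ≡ Σ[< suc n ] M + Σ[< n ] R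
    Σ-bk-top zero    = sym (+-identityʳ (M 0))
    Σ-bk-top (suc n) = begin
      (Σ[< n ] (bk R A) + bk R A n) + (Σ[< n ] A + A n) + top R (suc n)
        ≡⟨ rearrange (Σ[< n ] (bk R A)) (Σ[< n ] A) (top R (suc n)) (bk-+ n) ⟩
      Σ[< n ] (bk R A) + Σ[< n ] A + top R n + (bot R n + top R (suc n))
        ≡⟨ cong₂ _+_ (Σ-bk-top n) (⊔-+-⊓ (M (suc n)) (R n)) ⟩
      Σ[< suc n ] M + Σ[< n ] R + (M (suc n) + R n)
        ≡⟨ interchange (Σ[< suc n ] M) (Σ[< n ] R) (M (suc n)) (R n) ⟩
      Σ[< suc n ] M + M (suc n) + (Σ[< n ] R + R n) ∎
      where
      open ≡-Reasoning

      interchange : ∀ a b c d → a + b + (c + d) ≡ a + c + (b + d)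
      interchange = solve-∀

      rearrange : ∀ a b t {x y l h} → x + y ≡ l + h → (a + x) + (b + y) + t ≡ a + b + h + (l + t)
      rearrange a b t {x} {y} {l} {h} e = begin
        (a + x) + (b + y) + t ≡⟨ assoc a b t x y ⟩
        a + b + t + (x + y)   ≡⟨ cong (a + b + t +_) e ⟩
        a + b + t + (l + h)   ≡⟨ assoc′ a b t l h ⟩
        a + b + h + (l + t)   ∎
        where
        assoc : ∀ a b t x y → (a + x) + (b + y) + t ≡ a + b + t + (x + y)
        assoc = solve-∀
        assoc′ : ∀ a b t l h → a + b + t + (l + h) ≡ a + b + h + (l + t)
        assoc′ = solve-∀

    -- Both boundary terms, `M n` and `top R n`, vanish. With `A′` the reflected diagram this reads
    -- `|M| - |A′| = |A| - |R|`: the two strip sizes are exchanged.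
    Σ-bk : ∀ {n} → M n ≡ 0 → Σ[< n ] (bk R A) + Σ[< n ] A ≡ Σ[< n ] M + Σ[< n ] R
    Σ-bk {n} Mn≡0 = begin
      Σ[< n ] (bk R A) + Σ[< n ] A           ≡⟨ +-identityʳ _ ⟨
      Σ[< n ] (bk R A) + Σ[< n ] A + 0       ≡⟨ cong (Σ[< n ] (bk R A) + Σ[< n ] A +_) (n≤0⇒n≡0 (≤-trans (top≤M R n) (≤-reflexive Mn≡0))) ⟨
      Σ[< n ] (bk R A) + Σ[< n ] A + top R n ≡⟨ Σ-bk-top n ⟩
      Σ[< n ] M + M n + Σ[< n ] R            ≡⟨ cong (λ x → Σ[< n ] M + x + Σ[< n ] R) Mn≡0 ⟩
      Σ[< n ] M + 0 + Σ[< n ] R              ≡⟨ cong (_+ Σ[< n ] R) (+-identityʳ (Σ[< n ] M)) ⟩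
      Σ[< n ] M + Σ[< n ] R                  ∎
      where open ≡-Reasoning

  bk-cong : ∀ {R R′ A A′} → R ≗ R′ → A ≗ A′ → bk R A ≗ bk R′ A′
  bk-cong r a zero    = cong₂ (λ x y → M 1 ⊔ x + M 0 ∸ y) (r 0) (a 0)
  bk-cong r a (suc i) rewrite r i | r (suc i) | a (suc i) = refl

open BenderKnuth using (bk; M≽bk; bk≽R; bk-involutive; bk-cong; Σ-bk)

-- The local rule D U = (1 - xy)⁻¹ U D

module _ (A B : ℕ → ℕ) where

  -- The same bounds govern `S (suc i)` for `S` above `A` and `B`, and `R i` for `R` below both;
  -- hence the shift of rows in `lowered` and `raised`.
  lo hi : ℕ → ℕ
  lo i = A (suc i) ⊔ B (suc i)
  hi i = A i ⊓ B i

  lowered : (ℕ → ℕ) → ℕ → ℕ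
  lowered S i = reflect (lo i) (hi i) (S (suc i))

  -- Row 0 of `S` is bounded only from below and has no counterpart in `R`; recording this number
  -- makes `lowered` reversible.
  excess : (ℕ → ℕ) → ℕ
  excess S = S 0 ∸ (A 0 ⊔ B 0)

  raised : ℕ → (ℕ → ℕ) → ℕ → ℕ
  raised j R zero    = A 0 ⊔ B 0 + j
  raised j R (suc i) = reflect (lo i) (hi i) (R i)

module _ {A B S : ℕ → ℕ} (a : S ≽ A) (b : S ≽ B) where
  private
    lo≤ : ∀ i → lo A B i ≤ S (suc i)
    lo≤ i = ⊔-lub (upper a (suc i)) (upper b (suc i))

    ≤hi : ∀ i → S (suc i) ≤ hi A B i
    ≤hi i = ⊓-glb (lower a i) (lower b i)

    lo≤′ : ∀ i → lo A B i ≤ lowered A B S i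
    lo≤′ i = reflect-≥ (≤hi i)

    ≤hi′ : ∀ i → lowered A B S i ≤ hi A B i
    ≤hi′ i = reflect-≤ {lo A B i} (lo≤ i)

  ≽loweredˡ : A ≽ lowered A B S
  ≽loweredˡ .upper i = m≤n⊓o⇒m≤n _ _ (≤hi′ i)
  ≽loweredˡ .lower i = m⊔n≤o⇒m≤o _ _ (lo≤′ i)

  ≽loweredʳ : B ≽ lowered A B S
  ≽loweredʳ .upper i = m≤n⊓o⇒m≤o (A i) _ (≤hi′ i)
  ≽loweredʳ .lower i = m⊔n≤o⇒n≤o (A (suc i)) _ (lo≤′ i)

  raised-lowered : raised A B (excess A B S) (lowered A B S) ≗ S
  raised-lowered zero    = m+[n∸m]≡n (⊔-lub (upper a 0) (upper b 0))
  raised-lowered (suc i) = reflect-involutive {lo A B i} (≤hi i)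

module _ {A B R : ℕ → ℕ} (a : A ≽ R) (b : B ≽ R) (j : ℕ) where
  private
    lo≤ : ∀ i → lo A B i ≤ R i
    lo≤ i = ⊔-lub (lower a i) (lower b i)

    ≤hi : ∀ i → R i ≤ hi A B i
    ≤hi i = ⊓-glb (upper a i) (upper b i)

    lo≤′ : ∀ i → lo A B i ≤ raised A B j R (suc i)
    lo≤′ i = reflect-≥ (≤hi i)

    ≤hi′ : ∀ i → raised A B j R (suc i) ≤ hi A B i
    ≤hi′ i = reflect-≤ {lo A B i} (lo≤ i)

  raised≽ˡ : raised A B j R ≽ A
  raised≽ˡ .upper zero    = ≤-trans (m≤m⊔n _ _) (m≤m+n _ j)
  raised≽ˡ .upper (suc i) = m⊔n≤o⇒m≤o _ _ (lo≤′ i)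
  raised≽ˡ .lower i       = m≤n⊓o⇒m≤n _ _ (≤hi′ i)

  raised≽ʳ : raised A B j R ≽ B
  raised≽ʳ .upper zero    = ≤-trans (m≤n⊔m (A 0) _) (m≤m+n _ j)
  raised≽ʳ .upper (suc i) = m⊔n≤o⇒n≤o (A (suc i)) _ (lo≤′ i)
  raised≽ʳ .lower i       = m≤n⊓o⇒m≤o (A i) _ (≤hi′ i)

  lowered-raised : lowered A B (raised A B j R) ≗ R
  lowered-raised i = reflect-involutive {lo A B i} (≤hi i)

  excess-raised : excess A B (raised A B j R) ≡ j
  excess-raised = m+n∸m≡n (A 0 ⊔ B 0) j

  -- A telescoping sum: with `S` the raised diagram, `R n + S (suc n)` is `lo + hi` at `n`. Here
  -- `hi` completes the boundary maximum to `A n + B n`, and `lo` is the next boundary maximum.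
  Σ-raised-⊔ : ∀ n → Σ[< n ] R + Σ[< suc n ] (raised A B j R)
                   ≡ j + Σ[< n ] A + Σ[< n ] B + (A n ⊔ B n)
  Σ-raised-⊔ zero    = trans (+-comm (A 0 ⊔ B 0) j) (cong (_+ _) (trans (sym (+-identityʳ j)) (sym (+-identityʳ (j + 0)))))
  Σ-raised-⊔ (suc n) = begin
    (Σ[< n ] R + R n) + (Σ[< suc n ] S + S (suc n))
      ≡⟨ assoc (Σ[< n ] R) (R n) (Σ[< suc n ] S) (S (suc n)) ⟩
    (Σ[< n ] R + Σ[< suc n ] S) + (S (suc n) + R n)
      ≡⟨ cong₂ _+_ (Σ-raised-⊔ n) (reflect-+ {lo A B n} (≤hi n)) ⟩
    j + Σ[< n ] A + Σ[< n ] B + (A n ⊔ B n) + (lo A B n + hi A B n)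
      ≡⟨ assoc′ (j + Σ[< n ] A + Σ[< n ] B) (A n ⊔ B n) (lo A B n) (hi A B n) ⟩
    j + Σ[< n ] A + Σ[< n ] B + ((A n ⊔ B n) + (A n ⊓ B n)) + lo A B n
      ≡⟨ cong (λ x → j + Σ[< n ] A + Σ[< n ] B + x + lo A B n) (⊔-+-⊓ (A n) (B n)) ⟩
    j + Σ[< n ] A + Σ[< n ] B + (A n + B n) + lo A B n
      ≡⟨ assoc″ j (Σ[< n ] A) (Σ[< n ] B) (A n) (B n) (lo A B n) ⟩
    j + (Σ[< n ] A + A n) + (Σ[< n ] B + B n) + lo A B n ∎
    where
    open ≡-Reasoning
    S = raised A B j R
    assoc : ∀ a b c d → (a + b) + (c + d) ≡ (a + c) + (d + b)
    assoc = solve-∀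
    assoc′ : ∀ a b c d → a + b + (c + d) ≡ a + (b + d) + c
    assoc′ = solve-∀
    assoc″ : ∀ j a b c d e → j + a + b + (c + d) + e ≡ j + (a + c) + (b + d) + e
    assoc″ = solve-∀

  -- The boundary maximum vanishes. With `S` the raised diagram, `|S| - |A|` exceeds `|B| - |R|` by
  -- `j`, and so does `|S| - |B|` exceed `|A| - |R|`: this is the factor `(xy)^j`.
  Σ-raised : ∀ {n} → A n ≡ 0 → B n ≡ 0 →
             Σ[< n ] R + Σ[< suc n ] (raised A B j R) ≡ j + Σ[< n ] A + Σ[< n ] B
  Σ-raised {n} An≡0 Bn≡0 =
    trans (Σ-raised-⊔ n) (trans (cong (j + Σ[< n ] A + Σ[< n ] B +_) (cong₂ _⊔_ An≡0 Bn≡0)) (+-identityʳ _))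

lowered-cong : ∀ {A A′ B B′ S S′} → A ≗ A′ → B ≗ B′ → S ≗ S′ → lowered A B S ≗ lowered A′ B′ S′
lowered-cong a b s i rewrite a i | a (suc i) | b i | b (suc i) | s (suc i) = refl

excess-cong : ∀ {A A′ B B′ S S′} → A ≗ A′ → B ≗ B′ → S ≗ S′ → excess A B S ≡ excess A′ B′ S′
excess-cong a b s rewrite a 0 | b 0 | s 0 = refl

raised-cong : ∀ {A A′ B B′ R R′ j j′} → A ≗ A′ → B ≗ B′ → j ≡ j′ → R ≗ R′ →
              raised A B j R ≗ raised A′ B′ j′ R′
raised-cong a b j r zero    rewrite a 0 | b 0 | j = refl
raised-cong a b j r (suc i) rewrite a i | a (suc i) | b i | b (suc i) | r i = refl

Σ-cong : ∀ {f g} → f ≗ g → ∀ n → Σ[< n ] f ≡ Σ[< n ] g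
Σ-cong e zero    = refl
Σ-cong e (suc n) = cong₂ _+_ (Σ-cong e n) (e n)

-- Two consecutive steps

-- The intermediate diagrams of M → A → S → B → K, given by row lengths.
record Steps : Set where
  constructor steps
  field A S B : ℕ → ℕ

infix 4 _≈_

-- Agreement row by row suffices, since `part-injective` recovers the partitions from it.
record _≈_ (c d : Steps) : Set where
  constructor eqs
  field
    eqA : Steps.A c ≗ Steps.A d
    eqS : Steps.S c ≗ Steps.S d
    eqB : Steps.B c ≗ Steps.B d

≈-sym : ∀ {c d} → c ≈ d → d ≈ c
≈-sym (eqs a s b) = eqs (sym ∘ a) (sym ∘ s) (sym ∘ b)

≈-trans : ∀ {c d e} → c ≈ d → d ≈ e → c ≈ e
≈-trans (eqs a s b) (eqs a′ s′ b′) =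
  eqs (λ i → trans (a i) (a′ i)) (λ i → trans (s i) (s′ i)) (λ i → trans (b i) (b′ i))

-- Without subtraction, this is `(m - a′) + (s′ - a′) = (s - b) + (k - b)`: the new first weight is
-- the old second one. Adding `r + r` to both sides lets all four hypotheses apply.
balance : ∀ m k r a b a′ b′ s s′ j → a′ + a ≡ m + r → b′ + b ≡ k + r →
          r + s ≡ j + a + b → r + s′ ≡ j + a′ + b′ →
          m + s′ + (b + b) ≡ s + k + (a′ + a′)
balance m k r a b a′ b′ s s′ j bkA bkB low low′ =
  +-cancelʳ-≡ (r + r) _ _ $ begin
    m + s′ + (b + b) + (r + r)          ≡⟨ e₁ m s′ b r ⟩
    (m + r) + (r + s′) + (b + b)        ≡⟨ cong₂ (λ x y → x + y + (b + b)) (sym bkA) low′ ⟩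
    (a′ + a) + (j + a′ + b′) + (b + b)  ≡⟨ e₂ a′ a j b′ b ⟩
    (j + a + b) + (b′ + b) + (a′ + a′)  ≡⟨ cong₂ (λ x y → x + y + (a′ + a′)) (sym low) bkB ⟩
    (r + s) + (k + r) + (a′ + a′)       ≡⟨ e₃ r s k a′ ⟩
    s + k + (a′ + a′) + (r + r)         ∎
  where
  open ≡-Reasoning
  e₁ : ∀ m s′ b r → m + s′ + (b + b) + (r + r) ≡ (m + r) + (r + s′) + (b + b)
  e₁ = solve-∀
  e₂ : ∀ a′ a j b′ b → (a′ + a) + (j + a′ + b′) + (b + b) ≡ (j + a + b) + (b′ + b) + (a′ + a′)
  e₂ = solve-∀
  e₃ : ∀ r s k a′ → (r + s) + (k + r) + (a′ + a′) ≡ s + k + (a′ + a′) + (r + r)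
  e₃ = solve-∀

-- Passes from sizes back to strip lengths: `p`, `q` belong to strips over a diagram of size `a`,
-- and `t`, `u` to strips over one of size `b`.
weights-swap : ∀ p q t u {m s k s′ a b} → p + a ≡ m → q + a ≡ s′ → t + b ≡ s → u + b ≡ k →
               m + s′ + (b + b) ≡ s + k + (a + a) → p + q ≡ t + u
weights-swap p q t u {a = a} {b} refl refl refl refl e =
  +-cancelʳ-≡ (a + a + (b + b)) _ _ (trans (e₁ p q a b) (trans e (e₂ t u a b)))
  where
  e₁ : ∀ p q a b → p + q + (a + a + (b + b)) ≡ p + a + (q + a) + (b + b)
  e₁ = solve-∀
  e₂ : ∀ t u a b → t + b + (u + b) + (a + a) ≡ t + u + (a + a + (b + b))
  e₂ = solve-∀

module Exchange (M K : ℕ → ℕ) where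

  record Valid (c : Steps) : Set where
    constructor valid
    open Steps c
    field
      M≽A : M ≽ A
      S≽A : S ≽ A
      S≽B : S ≽ B
      K≽B : K ≽ B

  exchange : Steps → Steps
  exchange (steps A S B) = steps A′ (raised A′ B′ (excess A B S) R) B′
    where
    R  = lowered A B S
    A′ = bk M R A
    B′ = bk K R B

  exchange-valid : ∀ {c} → Valid c → Valid (exchange c)
  exchange-valid (valid ma sa sb kb) = valid (M≽bk M ma ar)
    (raised≽ˡ (bk≽R M ma ar) (bk≽R K kb br) _)
    (raised≽ʳ (bk≽R M ma ar) (bk≽R K kb br) _) (M≽bk K kb br)
    where
    ar = ≽loweredˡ sa sb
    br = ≽loweredʳ sa sb

  exchange-cong : ∀ {c d} → c ≈ d → exchange c ≈ exchange d
  exchange-cong (eqs a s b) = eqs a′ (raised-cong a′ b′ (excess-cong a b s) r) b′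
    where
    r  = lowered-cong a b s
    a′ = bk-cong M r a
    b′ = bk-cong K r b

  -- Lowering the exchanged steps gives back the same `R` and `j`. So the second pair of
  -- Bender-Knuth reflections is taken relative to the same diagrams and undoes the first, after
  -- which raising `R` restores `S`.
  exchange-involutive : ∀ {c} → Valid c → exchange (exchange c) ≈ c
  exchange-involutive {steps A S B} (valid ma sa sb kb) = eqs a″
    (λ i → trans (raised-cong a″ b″ (excess-raised ar′ br′ j) r i) (raised-lowered sa sb i)) b″
    where
    R   = lowered A B S
    j   = excess A B S
    ar  = ≽loweredˡ sa sb
    br  = ≽loweredʳ sa sb
    ar′ = bk≽R M ma ar
    br′ = bk≽R K kb br
    r   = lowered-raised ar′ br′ j
    a″ : bk M _ (bk M R A) ≗ A
    a″ i = trans (bk-cong M {A′ = bk M R A} r (λ _ → refl) i) (bk-involutive M ma ar i)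
    b″ : bk K _ (bk K R B) ≗ B
    b″ i = trans (bk-cong K {A′ = bk K R B} r (λ _ → refl) i) (bk-involutive K kb br i)

  module _ {c} (v : Valid c) where
    open Steps c
    open Steps (exchange c) renaming (A to A′; S to S′; B to B′)
    open Valid v

    module _ {n} (Mn : M n ≡ 0) (Kn : K n ≡ 0) where
      private
        R   = lowered A B S
        j   = excess A B S
        ar  = ≽loweredˡ S≽A S≽B
        br  = ≽loweredʳ S≽A S≽B
        ar′ = bk≽R M M≽A ar
        br′ = bk≽R K K≽B br

        m = Σ[< n ] M
        k = Σ[< n ] K
        r = Σ[< n ] R
        a = Σ[< n ] A
        b = Σ[< n ] B
        a′ = Σ[< n ] A′
        b′ = Σ[< n ] B′
        -- `S` may have one row more than `A` and `B`.
        s = Σ[< suc n ] S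
        s′ = Σ[< suc n ] S′

        bkA : a′ + a ≡ m + r
        bkA = Σ-bk M M≽A ar Mn

        bkB : b′ + b ≡ k + r
        bkB = Σ-bk K K≽B br Kn

        low : r + s ≡ j + a + b
        -- The old `S` is itself raised from `R`, so `Σ-raised` covers it as well.
        low = trans (cong (r +_) (sym (Σ-cong (raised-lowered S≽A S≽B) (suc n))))
                    (Σ-raised ar br j (0ˡ⇒0ʳ M≽A Mn) (0ˡ⇒0ʳ K≽B Kn))

        low′ : r + s′ ≡ j + a′ + b′
        low′ = Σ-raised ar′ br′ j (0ˡ⇒0ʳ (M≽bk M M≽A ar) Mn) (0ˡ⇒0ʳ (M≽bk K K≽B br) Kn)

      exchange-Σˡ : m + s′ + (b + b) ≡ s + k + (a′ + a′)
      exchange-Σˡ = balance m k r a b a′ b′ s s′ j bkA bkB low low′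

      -- The hypotheses of `balance` are symmetric under interchanging `M`, `A` with `K`, `B`.
      exchange-Σʳ : k + s′ + (a + a) ≡ s + m + (b′ + b′)
      exchange-Σʳ = balance k m r b a b′ a′ s s′ j bkB bkA (trans low (swap-last j a b)) (trans low′ (swap-last j a′ b′))
        where
        swap-last : ∀ x y z → x + y + z ≡ x + z + y
        swap-last = solve-∀

-- Partitions as sequences of row lengths

-- Padding with empty rows lets diagrams with different numbers of rows be compared at every index.
row : List ℕ → ℕ → ℕ
row []       _       = 0
row (x ∷ xs) zero    = x
row (x ∷ xs) (suc i) = row xs i

part : Partition → ℕ → ℕ
part μ = row (parts μ)

row-decreasing : ∀ {xs} → Linked _≥_ xs → ∀ i → row xs (suc i) ≤ row xs i
row-decreasing []      _       = z≤n
row-decreasing [-]     _       = z≤n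
row-decreasing (p ∷ _) zero    = p
row-decreasing (_ ∷ l) (suc i) = row-decreasing l i

Decreasing : (ℕ → ℕ) → Set
Decreasing f = ∀ i → f (suc i) ≤ f i

antitone : ∀ {f i j} → Decreasing f → i ≤ j → f j ≤ f i
antitone {f} {i} d i≤j with k , refl ← m≤n⇒∃[o]m+o≡n i≤j = go k
  where
  go : ∀ k → f (i + k) ≤ f i
  go zero    = ≤-reflexive (cong f (+-identityʳ i))
  go (suc k) = ≤-trans (≤-reflexive (cong f (+-suc i k))) (≤-trans (d (i + k)) (go k))

antitone-0 : ∀ {f i j} → Decreasing f → f i ≡ 0 → i ≤ j → f j ≡ 0
antitone-0 d fi≡0 i≤j = n≤0⇒n≡0 (≤-trans (antitone d i≤j) (≤-reflexive fi≡0))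

row≡0 : ∀ {i} xs → length xs ≤ i → row xs i ≡ 0
row≡0 []                _       = refl
row≡0 {suc i} (x ∷ xs) (s≤s p) = row≡0 xs p

-- Positivity of the parts makes the padding lossless: where one list ends and the other continues,
-- the row lengths differ.
part-injective : ∀ {μ ν} → part μ ≗ part ν → μ ≡ ν
part-injective {mkPartition _ _ p} {mkPartition _ _ q} e = parts-injective (go p q e)
  where
  go : ∀ {xs ys} → All (0 <_) xs → All (0 <_) ys → row xs ≗ row ys → xs ≡ ys
  go []      []      e = refl
  go []      (q ∷ _) e = contradiction (e 0) (<⇒≢ q)
  go (p ∷ _) []      e = contradiction (sym (e 0)) (<⇒≢ p)
  go (_ ∷ p) (_ ∷ q) e = cong₂ _∷_ (e 0) (go p q (e ∘ suc))

rowList : ℕ → (ℕ → ℕ) → List ℕ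
rowList zero    f = []
rowList (suc n) f with f 0
... | zero  = []
... | suc x = suc x ∷ rowList n (f ∘ suc)

rowList-positive : ∀ n f → All (0 <_) (rowList n f)
rowList-positive zero    f = []
rowList-positive (suc n) f with f 0
... | zero  = []
... | suc x = z<s ∷ rowList-positive n (f ∘ suc)

rowList-linked : ∀ n {f} → Decreasing f → Linked _≥_ (rowList n f)
rowList-linked zero        d = []
rowList-linked (suc n) {f} d with f 0 | d 0
... | zero  | _   = []
... | suc x | f1≤ = cons n f1≤ (rowList-linked n (d ∘ suc))
  where
  cons : ∀ n {x g} → g 0 ≤ x → Linked _≥_ (rowList n g) → Linked _≥_ (x ∷ rowList n g)
  cons zero            _  _ = [-]
  cons (suc n) {g = g} g≤ l with g 0
  ... | zero  = [-]
  ... | suc _ = g≤ ∷ l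

-- A decreasing sequence stays zero after its first zero, so cutting it off there, or at the bound
-- `n`, loses nothing.
row-rowList : ∀ n {f} → Decreasing f → f n ≡ 0 → row (rowList n f) ≗ f
row-rowList zero        d f0 i = sym (antitone-0 d f0 z≤n)
row-rowList (suc n) {f} d fn i with f 0 in eq
row-rowList (suc n) {f} d fn i       | zero  = sym (antitone-0 d eq z≤n)
row-rowList (suc n) {f} d fn zero    | suc x = sym eq
row-rowList (suc n) {f} d fn (suc i) | suc x = row-rowList n (d ∘ suc) fn i

fromRows : ∀ n {f} → Decreasing f → Partition
fromRows n {f} d = mkPartition (rowList n f) (rowList-linked n d) (rowList-positive n f)

part-decreasing : ∀ μ → Decreasing (part μ)
part-decreasing μ = row-decreasing (decreasing μ)

size-Σ : ∀ μ {n} → part μ n ≡ 0 → size μ ≡ Σ[< n ] (part μ)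
size-Σ (mkPartition xs _ p) = go 0 p
  where
  go : ∀ l {xs n} → All (0 <_) xs → row xs n ≡ 0 → length (boxesFrom l xs) ≡ Σ[< n ] (row xs)
  go l {n = n} []          _ = sym (Σ-0 n)
  go l {n = zero}  (p ∷ _) e = contradiction (sym e) (<⇒≢ p)
  go l {x ∷ xs} {suc n} (_ ∷ p) e = begin
    length (boxesFrom l (x ∷ xs))       ≡⟨ length-boxesFrom l x xs ⟩
    x + length (boxesFrom (suc l) xs)   ≡⟨ cong (x +_) (go (suc l) p e) ⟩
    x + Σ[< n ] (row xs)                ≡⟨ Σ-suc n (row (x ∷ xs)) ⟨
    Σ[< suc n ] (row (x ∷ xs))          ∎
    where open ≡-Reasoning

∈-boxesFrom⁺ : ∀ k xs {l m} → m < row xs l → (k + l , m) ∈ boxesFrom k xs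
∈-boxesFrom⁺ k (x ∷ xs) {zero} m<
  rewrite +-identityʳ k = ∈-++⁺ˡ (∈-map⁺ (k ,_) (∈-upTo⁺ m<))
∈-boxesFrom⁺ k (x ∷ xs) {suc l} m<
  rewrite +-suc k l = ∈-++⁺ʳ (map (k ,_) (upTo x)) (∈-boxesFrom⁺ (suc k) xs m<)

∈-boxesFrom⁻ : ∀ k xs {l m} → (k + l , m) ∈ boxesFrom k xs → m < row xs l
∈-boxesFrom⁻ k (x ∷ xs) {l} b∈ with ∈-++⁻ (map (k ,_) (upTo x)) b∈
∈-boxesFrom⁻ k (x ∷ xs) {zero}  b∈ | inj₁ p
  with _ , q , e ← ∈-map⁻ (k ,_) p = subst (_< x) (sym (cong proj₂ e)) (∈-upTo⁻ q)
∈-boxesFrom⁻ k (x ∷ xs) {suc l} b∈ | inj₁ p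
  with _ , _ , e ← ∈-map⁻ (k ,_) p = contradiction (cong proj₁ e) (m+1+n≢m k)
∈-boxesFrom⁻ k (x ∷ xs) {zero}  b∈ | inj₂ p
  = contradiction (row≤ (suc k) xs p) (<⇒≱ (s≤s (≤-reflexive (+-identityʳ k))))
∈-boxesFrom⁻ k (x ∷ xs) {suc l} b∈ | inj₂ p
  rewrite +-suc k l = ∈-boxesFrom⁻ (suc k) xs p

∈-boxes⁺ : ∀ μ {l m} → m < part μ l → (l , m) ∈ boxes μ
∈-boxes⁺ μ = ∈-boxesFrom⁺ 0 (parts μ)

∈-boxes⁻ : ∀ μ {l m} → (l , m) ∈ boxes μ → m < part μ l
∈-boxes⁻ μ = ∈-boxesFrom⁻ 0 (parts μ)

∈-∖⁺ : ∀ μ ν {l m} → part ν l ≤ m → m < part μ l → (l , m) ∈ μ ∖ ν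
∈-∖⁺ μ ν ν≤m m<μ = ∈-filter⁺ (λ b → ¬? (b ∈? boxes ν)) (∈-boxes⁺ μ m<μ) λ p → <⇒≱ (∈-boxes⁻ ν p) ν≤m

∈-∖⁻ : ∀ μ ν {l m} → (l , m) ∈ μ ∖ ν → part ν l ≤ m × m < part μ l
∈-∖⁻ μ ν b∈ with p , ¬q ← ∈-filter⁻ (λ b → ¬? (b ∈? boxes ν)) {xs = boxes μ} b∈ =
  ≮⇒≥ (λ m< → ¬q (∈-boxes⁺ ν m<)) , ∈-boxes⁻ μ p

strip⇒≽ : ∀ {μ ν} → HorizontalStrip μ ν → part μ ≽ part ν
strip⇒≽ {μ} {ν} h .upper i = ≮⇒≥ λ μ<ν →
  <-irrefl refl (∈-boxes⁻ μ (HorizontalStrip.contains h (∈-boxes⁺ ν μ<ν)))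
-- Otherwise column `part ν i` would meet `μ ∖ ν` in both rows `i` and `suc i`.
strip⇒≽ {μ} {ν} h .lower i = ≮⇒≥ λ ν<μ →
  1+n≢n (HorizontalStrip.columns h (∈-∖⁺ μ ν (part-decreasing ν i) ν<μ)
                                   (∈-∖⁺ μ ν ≤-refl (<-≤-trans ν<μ (part-decreasing μ i))))

≽⇒strip : ∀ {μ ν} → part μ ≽ part ν → HorizontalStrip μ ν
≽⇒strip {μ} {ν} h = strip (λ {b} b∈ → ∈-boxes⁺ μ (<-≤-trans (∈-boxes⁻ ν b∈) (upper h (proj₁ b)))) columns
  where
  -- Such boxes would force `m < part μ l′ ≤ part μ (suc l) ≤ part ν l ≤ m`.
  not-above : ∀ {l l′ m} → (l , m) ∈ μ ∖ ν → (l′ , m) ∈ μ ∖ ν → l ≮ l′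
  not-above b∈ b′∈ l<l′ with ν≤m , _ ← ∈-∖⁻ μ ν b∈ | _ , m<μ ← ∈-∖⁻ μ ν b′∈ =
    <⇒≱ m<μ (≤-trans (antitone (part-decreasing μ) l<l′) (≤-trans (lower h _) ν≤m))

  columns : ∀ {l l′ m} → (l , m) ∈ μ ∖ ν → (l′ , m) ∈ μ ∖ ν → l ≡ l′
  columns {l} {l′} b∈ b′∈ with <-cmp l l′
  ... | tri< l<l′ _ _ = contradiction l<l′ (not-above b∈ b′∈)
  ... | tri≈ _ l≡l′ _ = l≡l′
  ... | tri> _ _ l>l′ = contradiction l>l′ (not-above b′∈ b∈)

-- One inequality is `size-∖`; for the other, `boxes ν` and `μ ∖ ν` are disjoint, free of
-- repetitions and contained in `boxes μ`.
length-∖ : ∀ {μ ν} → HorizontalStrip μ ν → length (μ ∖ ν) + size ν ≡ size μ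
length-∖ {μ} {ν} h = trans (+-comm (length (μ ∖ ν)) (size ν)) (≤-antisym
  (subst (_≤ size μ) (length-++ (boxes ν)) (length-mono unique λ b∈ → sub (∈-++⁻ (boxes ν) b∈)))
  (size-∖ μ ν))
  where
  out? = λ b → ¬? (b ∈? boxes ν)
  unique : Unique (boxes ν ++ (μ ∖ ν))
  unique = Uniqueₚ.++⁺ (boxesFrom-unique 0 (parts ν))
    (Uniqueₚ.filter⁺ out? (boxesFrom-unique 0 (parts μ)))
    λ (p , q) → proj₂ (∈-filter⁻ out? {xs = boxes μ} q) p
  sub : ∀ {b} → b ∈ boxes ν ⊎ b ∈ μ ∖ ν → b ∈ boxes μ
  sub (inj₁ p) = HorizontalStrip.contains h p
  sub (inj₂ q) = proj₁ (∈-filter⁻ out? {xs = boxes μ} q)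

-- The exchange on partitions

≽-resp : ∀ {f f′ g g′} → f ≗ f′ → g ≗ g′ → f ≽ g → f′ ≽ g′
≽-resp f≗ g≗ h .upper i = subst₂ _≤_ (g≗ i) (f≗ i) (upper h i)
≽-resp f≗ g≗ h .lower i = subst₂ _≤_ (f≗ (suc i)) (g≗ i) (lower h i)

record TwoSteps (μ κ : Partition) : Set where
  constructor twoSteps
  field
    {α σ β} : Partition
    μ/α     : HorizontalStrip μ α
    σ/α     : HorizontalStrip σ α
    σ/β     : HorizontalStrip σ β
    κ/β     : HorizontalStrip κ β

  weight₁ weight₂ : ℕ
  weight₁ = length (μ ∖ α) + length (σ ∖ α)
  weight₂ = length (σ ∖ β) + length (κ ∖ β)

  toSteps : Steps
  toSteps = steps (part α) (part σ) (part β)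

module _ {μ κ : Partition} where
  open Exchange (part μ) (part κ)

  toSteps-valid : (c : TwoSteps μ κ) → Valid (TwoSteps.toSteps c)
  toSteps-valid (twoSteps ma sa sb kb) = valid (strip⇒≽ ma) (strip⇒≽ sa) (strip⇒≽ sb) (strip⇒≽ kb)

  module _ {c : Steps} (v : Valid c) where
    open Steps c
    open Valid v
    private
      N : ℕ
      -- A common index past the last rows of both outer diagrams.
      N = rows μ + rows κ

      μN : part μ N ≡ 0
      μN = row≡0 (parts μ) (m≤m+n _ _)

      κN : part κ N ≡ 0
      κN = row≡0 (parts κ) (m≤n+m _ (rows μ))

      α σ β : Partition
      α = fromRows N (decreasingʳ M≽A)
      -- Interlacing with `A`, which vanishes at `N`, forces `S` to vanish only from `suc N` on.
      σ = fromRows (suc N) (decreasingˡ S≽A)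
      β = fromRows N (decreasingʳ K≽B)

      partα : part α ≗ A
      partα = row-rowList N (decreasingʳ M≽A) (0ˡ⇒0ʳ M≽A μN)

      partσ : part σ ≗ S
      partσ = row-rowList (suc N) (decreasingˡ S≽A) (0ʳ⇒0ˡ S≽A (0ˡ⇒0ʳ M≽A μN))

      partβ : part β ≗ B
      partβ = row-rowList N (decreasingʳ K≽B) (0ˡ⇒0ʳ K≽B κN)

    fromSteps : TwoSteps μ κ
    fromSteps = twoSteps {α = α} {σ} {β}
                         (≽⇒strip (≽-resp (λ _ → refl) (sym ∘ partα) M≽A))
                         (≽⇒strip (≽-resp (sym ∘ partσ) (sym ∘ partα) S≽A))
                         (≽⇒strip (≽-resp (sym ∘ partσ) (sym ∘ partβ) S≽B))
                         (≽⇒strip (≽-resp (λ _ → refl) (sym ∘ partβ) K≽B))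

    toSteps-fromSteps : TwoSteps.toSteps fromSteps ≈ c
    toSteps-fromSteps = eqs partα partσ partβ

  abstract
    exchanged : TwoSteps μ κ → TwoSteps μ κ
    exchanged c = fromSteps (exchange-valid (toSteps-valid c))

    toSteps-exchanged : ∀ c → TwoSteps.toSteps (exchanged c) ≈ exchange (TwoSteps.toSteps c)
    toSteps-exchanged c = toSteps-fromSteps (exchange-valid (toSteps-valid c))

  -- Applying `exchange` once more to the common image recovers both arguments.
  exchanged-injective : ∀ c d → TwoSteps.toSteps (exchanged c) ≡ TwoSteps.toSteps (exchanged d) →
                        TwoSteps.toSteps c ≈ TwoSteps.toSteps d
  exchanged-injective c d e =
    ≈-trans (≈-sym (exchange-involutive (toSteps-valid c)))
    (≈-trans (exchange-cong exchange≈) (exchange-involutive (toSteps-valid d)))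
    where
    exchange≈ : exchange (TwoSteps.toSteps c) ≈ exchange (TwoSteps.toSteps d)
    exchange≈ = ≈-trans (≈-sym (toSteps-exchanged c))
                        (subst (_≈ exchange (TwoSteps.toSteps d)) (sym e) (toSteps-exchanged d))

  module _ (c : TwoSteps μ κ) where
    private
      open module C = TwoSteps c
      open module D = TwoSteps (exchanged c)
        renaming (α to α′; σ to σ′; β to β′; μ/α to μ/α′; σ/α to σ′/α′; σ/β to σ′/β′; κ/β to κ/β′)
        using ()

      n : ℕ
      n = rows μ + rows κ

      open _≈_ (toSteps-exchanged c)

      v : Valid C.toSteps
      v = toSteps-valid c

      v′ : Valid D.toSteps
      v′ = toSteps-valid (exchanged c)

      M0 : part μ n ≡ 0
      M0 = row≡0 (parts μ) (m≤m+n _ _)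

      K0 : part κ n ≡ 0
      K0 = row≡0 (parts κ) (m≤n+m _ (rows μ))

      size-of : ∀ ν {f} n → part ν ≗ f → part ν n ≡ 0 → size ν ≡ Σ[< n ] f
      size-of ν n e ν0 = trans (size-Σ ν ν0) (Σ-cong e n)

      A0 : ∀ {c} → Valid c → Steps.A c n ≡ 0
      A0 w = 0ˡ⇒0ʳ (Valid.M≽A w) M0

      S0 : ∀ {c} → Valid c → Steps.S c (suc n) ≡ 0
      S0 w = 0ʳ⇒0ˡ (Valid.S≽A w) (A0 w)

      B0 : ∀ {c} → Valid c → Steps.B c n ≡ 0
      B0 w = 0ˡ⇒0ʳ (Valid.K≽B w) K0

      via : ∀ {μ ν x y} → HorizontalStrip μ ν → size ν ≡ y → size μ ≡ x → length (μ ∖ ν) + y ≡ x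
      via h refl refl = length-∖ h

      sμ  = size-Σ μ M0
      sκ  = size-Σ κ K0
      sα  = size-Σ α (A0 v)
      sβ  = size-Σ β (B0 v)
      sσ  = size-Σ σ (S0 v)
      -- The new sizes are summed over the rows of `exchange C.toSteps`, the form in which
      -- `exchange-Σˡ` and `exchange-Σʳ` give them.
      sα′ = size-of α′ n eqA (A0 v′)
      sβ′ = size-of β′ n eqB (B0 v′)
      sσ′ = size-of σ′ (suc n) eqS (S0 v′)

    weight₁-exchanged : TwoSteps.weight₁ (exchanged c) ≡ TwoSteps.weight₂ c
    weight₁-exchanged = weights-swap (length (μ ∖ α′)) (length (σ′ ∖ α′)) (length (σ ∖ β)) (length (κ ∖ β))
                          (via μ/α′ sα′ sμ) (via σ′/α′ sα′ sσ′) (via σ/β sβ sσ) (via κ/β sβ sκ)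
                          (exchange-Σˡ v M0 K0)

    weight₂-exchanged : TwoSteps.weight₂ (exchanged c) ≡ TwoSteps.weight₁ c
    weight₂-exchanged = trans (+-comm (length (σ′ ∖ β′)) (length (κ ∖ β′))) (trans
      (weights-swap (length (κ ∖ β′)) (length (σ′ ∖ β′)) (length (σ ∖ α)) (length (μ ∖ α))
        (via κ/β′ sβ′ sκ) (via σ′/β′ sβ′ sσ′) (via σ/α sα sσ) (via μ/α sα sμ)
        (exchange-Σʳ v M0 K0))
      (+-comm (length (σ ∖ α)) (length (μ ∖ α))))

-- Counting tableaux

-- The map may use the proof of P x, but injectivity concerns only the elements.
infix 4 _↪_

record _↪_ {A : Set} (P Q : A → Set) : Set where
  field
    to        : ∀ {x} → P x → A
    sat       : ∀ {x} (p : P x) → Q (to p)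
    injective : ∀ {x y} (p : P x) (q : P y) → to p ≡ to q → x ≡ y

open _↪_

↪-refl : ∀ {A} {P : A → Set} → P ↪ P
↪-refl .to {x} _       = x
↪-refl .sat p          = p
↪-refl .injective _ _ e = e

↪-trans : ∀ {A} {P Q R : A → Set} → P ↪ Q → Q ↪ R → P ↪ R
↪-trans f g .to p            = to g (sat f p)
↪-trans f g .sat p           = sat g (sat f p)
↪-trans f g .injective p q e = injective f p q (injective g (sat f p) (sat f q) e)

module _ {A : Set} where
  lookup-injective : ∀ {xs : List A} → Unique xs → ∀ {i j} →
                     List.lookup xs i ≡ List.lookup xs j → i ≡ j
  lookup-injective (_ ∷ _)  {Fin.zero}  {Fin.zero}  _ = refl
  lookup-injective (p ∷ _) {Fin.zero}  {Fin.suc j} e = contradiction e (All.lookup p (∈-lookup j))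
  lookup-injective (p ∷ _) {Fin.suc i} {Fin.zero}  e = contradiction (sym e) (All.lookup p (∈-lookup i))
  lookup-injective (_ ∷ u) {Fin.suc i} {Fin.suc j} e = cong Fin.suc (lookup-injective u e)

  -- Each position in `xs` is sent to a position in `ys` of the image of its entry; uniqueness of
  -- `xs` makes this injective.
  ↪⇒length≤ : ∀ {xs ys : List A} → Unique xs → (_∈ xs) ↪ (_∈ ys) → length xs ≤ length ys
  ↪⇒length≤ {xs} {ys} u f = injective⇒≤ {f = pos} λ {i} {j} e → lookup-injective u
    (injective f (∈-lookup i) (∈-lookup j)
      (trans (Anyₚ.lookup-index (sat f (∈-lookup i)))
      (trans (cong (List.lookup ys) e) (sym (Anyₚ.lookup-index (sat f (∈-lookup j)))))))
    where
    pos : Fin (length xs) → Fin (length ys)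
    pos i = index (sat f (∈-lookup i))

-- The initial diagram is arbitrary, so that tails are again of this kind and induction applies.
Tableau : ∀ {k} → Partition → Partition → Vec ℕ k → Sequence k → Set
Tableau μ κ w S = Oscillates μ S κ × weightFrom μ S ≡ w

-- The first step is kept. The tail starts at a diagram that depends on the tableau, hence an
-- injection for every `ν`.
prepend : ∀ {k x μ κ} {v w : Vec ℕ k} → (∀ ν → Tableau ν κ v ↪ Tableau ν κ w) →
          Tableau μ κ (x ∷ v) ↪ Tableau μ κ (x ∷ w)
prepend f .to {(ν′ , ν) ∷ S} (step _ _ o , e) = (ν′ , ν) ∷ to (f ν) (o , Vecₚ.∷-injectiveʳ e)
prepend f .sat {(ν′ , ν) ∷ S} (step h h′ o , e)
  with o′ , e′ ← sat (f ν) (o , Vecₚ.∷-injectiveʳ e) =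
  step h h′ o′ , cong₂ _∷_ (Vecₚ.∷-injectiveˡ e) e′
prepend f .injective {_ ∷ _} {_ ∷ _} (step _ _ o , e) (step _ _ o′ , e′) eq
  with refl ← Vecₚ.∷-injectiveˡ eq =
  cong (_ ∷_) (injective (f _) (o , Vecₚ.∷-injectiveʳ e) (o′ , Vecₚ.∷-injectiveʳ e′) (Vecₚ.∷-injectiveʳ eq))

-- The exchange fixes the outer diagrams, so the tail after the second step still fits and keeps its
-- weight.
swapFirst : ∀ {k x y μ κ} {w : Vec ℕ k} → Tableau μ κ (x ∷ y ∷ w) ↪ Tableau μ κ (y ∷ x ∷ w)
swapFirst .to {_ ∷ (_ , ν) ∷ S} (step h₁ h₂ (step h₃ h₄ o) , e) = (α , σ) ∷ (β , ν) ∷ S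
  where open TwoSteps (exchanged (twoSteps h₁ h₂ h₃ h₄))
swapFirst .sat {_ ∷ _ ∷ S} (step h₁ h₂ (step h₃ h₄ o) , e) =
  step μ/α σ/α (step σ/β κ/β o) ,
  cong₂ _∷_ (trans (weight₁-exchanged c) (Vecₚ.∷-injectiveˡ (Vecₚ.∷-injectiveʳ e)))
 (cong₂ _∷_ (trans (weight₂-exchanged c) (Vecₚ.∷-injectiveˡ e))
            (Vecₚ.∷-injectiveʳ (Vecₚ.∷-injectiveʳ e)))
  where
  c = twoSteps h₁ h₂ h₃ h₄
  open TwoSteps (exchanged c)
swapFirst .injective {_ ∷ _ ∷ _} {_ ∷ _ ∷ _}
  (step h₁ h₂ (step h₃ h₄ o) , _) (step g₁ g₂ (step g₃ g₄ o′) , _) eq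
  with e₁ , e₂₃ ← Vecₚ.∷-injective eq
  with e₂ , refl ← Vecₚ.∷-injective e₂₃
  with eα , eσ ← Productₚ.,-injective e₁
  -- Both exchanges now lie between the same outer diagrams, as `exchanged-injective` requires.
  with eβ , refl ← Productₚ.,-injective e₂
  with eqs a s b ← exchanged-injective (twoSteps h₁ h₂ h₃ h₄) (twoSteps g₁ g₂ g₃ g₄)
    (trans (cong₂ (λ α σ → steps (part α) (part σ) _) eα eσ) (cong (λ β → steps _ _ (part β)) eβ)) =
  cong₂ (λ p q → p ∷ q ∷ _) (cong₂ _,_ (part-injective a) (part-injective s))
                            (cong (_, _) (part-injective b))

-- Permutations of exponent vectors

infix 4 _~_

-- Generated by adjacent transpositions, so that each constructor has its own injection of tableaux.
data _~_ : ∀ {k} → Vec ℕ k → Vec ℕ k → Set where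
  refl~  : ∀ {k} {v : Vec ℕ k} → v ~ v
  prep   : ∀ {k} x {v w : Vec ℕ k} → v ~ w → (x ∷ v) ~ (x ∷ w)
  swap   : ∀ {k} x y {v : Vec ℕ k} → (x ∷ y ∷ v) ~ (y ∷ x ∷ v)
  trans~ : ∀ {k} {u v w : Vec ℕ k} → u ~ v → v ~ w → u ~ w

sym~ : ∀ {k} {v w : Vec ℕ k} → v ~ w → w ~ v
sym~ refl~        = refl~
sym~ (prep x p)   = prep x (sym~ p)
sym~ (swap x y)   = swap y x
sym~ (trans~ p q) = trans~ (sym~ q) (sym~ p)

-- Adjacent transpositions carry entry `i` to the front.
lookup∷removeAt : ∀ {k} (v : Vec ℕ (suc k)) i → (Vec.lookup v i ∷ Vec.removeAt v i) ~ v
lookup∷removeAt (x ∷ v)         Fin.zero    = refl~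
lookup∷removeAt (x ∷ v@(_ ∷ _)) (Fin.suc i) = trans~ (swap _ x) (prep x (lookup∷removeAt v i))

removeAt-punchIn : ∀ {k} (v : Vec ℕ (suc k)) i j →
                   Vec.lookup (Vec.removeAt v i) j ≡ Vec.lookup v (Fin.punchIn i j)
removeAt-punchIn (x ∷ v)         Fin.zero    j           = refl
removeAt-punchIn (x ∷ v@(_ ∷ _)) (Fin.suc i) Fin.zero    = refl
removeAt-punchIn (x ∷ v@(_ ∷ _)) (Fin.suc i) (Fin.suc j) = removeAt-punchIn v i j

-- The entry at the image of `zero` comes first; the others are `removeAt v i` permuted by
-- `remove zero σ`, to which induction applies.
permute~ : ∀ {k} (σ : Permutation′ k) v → Vec.tabulate (λ i → Vec.lookup v (σ ⟨$⟩ʳ i)) ~ v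
permute~ {zero}  σ [] = refl~
permute~ {suc k} σ v = trans~
  (subst (λ w → (Vec.lookup v i ∷ Vec.tabulate (λ j → Vec.lookup v (σ ⟨$⟩ʳ Fin.suc j))) ~ (Vec.lookup v i ∷ w))
    (Vecₚ.tabulate-cong λ j → sym (trans (removeAt-punchIn v i (Perm.remove Fin.zero σ ⟨$⟩ʳ j))
                                    (cong (Vec.lookup v) (sym (Perm.punchIn-permute σ Fin.zero j)))))
    refl~)
  (trans~ (prep _ (permute~ (Perm.remove Fin.zero σ) (Vec.removeAt v i))) (lookup∷removeAt v i))
  where i = σ ⟨$⟩ʳ Fin.zero

-- Symmetry of the series

~⇒↪ : ∀ {k κ} {v w : Vec ℕ k} → v ~ w → ∀ μ → Tableau μ κ v ↪ Tableau μ κ w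
~⇒↪ refl~        μ = ↪-refl
~⇒↪ (prep x p)   μ = prepend (~⇒↪ p)
~⇒↪ (swap x y)   μ = swapFirst
~⇒↪ (trans~ p q) μ = ↪-trans (~⇒↪ p μ) (~⇒↪ q μ)

-- An injection gives one inequality; as `_~_` is symmetric, the reverse one follows in the same
-- way.
~⇒ss≤ : ∀ {k} κ {v w : Vec ℕ k} → v ~ w → ss k κ v ≤ ss k κ w
~⇒ss≤ {k} κ {v} {w} p = ↪⇒length≤ (tableaux-unique k κ v)
  (↪-trans out (↪-trans (~⇒↪ p ∅) into))
  where
  out : (_∈ tableaux k κ v) ↪ Tableau ∅ κ v
  out .to {S} _         = S
  out .sat              = Equivalence.to ∈-tableaux
  out .injective _ _ e  = e
  into : Tableau ∅ κ w ↪ (_∈ tableaux k κ w)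
  into .to {S} _        = S
  into .sat             = Equivalence.from ∈-tableaux
  into .injective _ _ e = e

theorem4p28 : ∀ (k : ℕ) .{{_ : NonZero k}} (κ : Partition) → rows κ ≤ k → Symmetric (ss k κ)
theorem4p28 k κ _ σ α = ≤-antisym (~⇒ss≤ κ (permute~ σ α)) (~⇒ss≤ κ (sym~ (permute~ σ α)))
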